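{- Let $m,n\geq 2$ be two distinct integers and $k\geq 2$. Then $$\Phi_k (P_m \square P_n)=\frac{1}{4}\left( k^{mn}-k^{m\lceil \frac{n}{2}\rceil}-k^{n\lceil \frac{m}{2}\rceil} -k^{\lceil \frac{mn}{2}\rceil} +2 k^{\lceil \frac{m}{2}\rceil\lceil \frac{n}{2}\rceil}\right).$$
   Context: $P_n$ is the path on $n$ vertices and $\square$ is the Cartesian product ($V(G\square H)=V(G)\times V(H)$, $(g,h)\sim(g',h')$ iff $g=g'$ and $hh'\in E(H)$, or $gg'\in E(G)$ and $h=h'$). A vertex coloring is distinguishing if the identity is the only automorphism preserving it. Two colorings $c_1,c_2$ of a graph $G$ are equivalent if there is an automorphism $\alpha$ of $G$ with $c_1(v)=c_2(\alpha(v))$ for all $v\in V(G)$. $\Phi_k(G)$ denotes the number of non-equivalent distinguishing vertex colorings of $G$ with colors from $\{1,\ldots,k\}$ (not all colors need be used). -}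

module Defs where

open import Data.Nat using (ℕ; suc)
open import Data.Nat.Properties using (1+n≢n)
open import Data.Fin using (Fin; toℕ)
open import Data.Product using (Σ; _×_; _,_; proj₁)
open import Level using (0ℓ)
open import Data.Sum using (_⊎_; inj₁; inj₂; swap)
open import Function.Bundles using (_↔_; _⇔_; module Inverse; module Equivalence; Inverse; mk⇔)
open import Function.Construct.Identity using (↔-id)
open import Function.Construct.Symmetry using (↔-sym)
open import Function.Construct.Composition using (_↔-∘_)
open import Relation.Nullary using (¬_)
open import Relation.Binary.Bundles using (Setoid)
open import Relation.Binary.PropositionalEquality using (_≡_; refl; sym; trans; cong; subst₂; setoid)

record Graph : Set₁ where
  field
    V        : Set
    _~_      : V → V → Set
    ~-sym    : ∀ {u v} → u ~ v → v ~ u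
    ~-irrefl : ∀ {v} → ¬ (v ~ v)

open Graph using (V)

P : ℕ → Graph
P n = record
  { V        = Fin n
  ; _~_      = λ i j → toℕ j ≡ suc (toℕ i) ⊎ toℕ i ≡ suc (toℕ j)
  ; ~-sym    = swap
  ; ~-irrefl = λ { (inj₁ e) → 1+n≢n (sym e) ; (inj₂ e) → 1+n≢n (sym e) }
  }

infixr 6 _□_

_□_ : Graph → Graph → Graph
G □ H = record
  { V        = G.V × H.V
  ; _~_      = λ { (g , h) (g′ , h′) → (g ≡ g′ × h H.~ h′) ⊎ (g G.~ g′ × h ≡ h′) }
  ; ~-sym    = λ { (inj₁ (e , a)) → inj₁ (sym e , H.~-sym a)
                 ; (inj₂ (a , e)) → inj₂ (G.~-sym a , sym e) }
  ; ~-irrefl = λ { (inj₁ (_ , a)) → H.~-irrefl a ; (inj₂ (a , _)) → G.~-irrefl a }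
  }
  where
  module G = Graph G
  module H = Graph H

record Automorphism (G : Graph) : Set where
  open Graph G using (_~_)
  field
    perm     : V G ↔ V G
  open Inverse perm public using (to; from; strictlyInverseˡ; strictlyInverseʳ)
  field
    preserves : ∀ u v → u ~ v ⇔ to u ~ to v

open Automorphism using (to)

module _ {G : Graph} where
  open Graph G using (_~_)

  idᴬ : Automorphism G
  idᴬ = record { perm = ↔-id _ ; preserves = λ _ _ → mk⇔ (λ a → a) (λ a → a) }

  invᴬ : Automorphism G → Automorphism G
  invᴬ α = record
    { perm      = ↔-sym α.perm
    ; preserves = λ u v → mk⇔
        (λ a → Equivalence.from (α.preserves (α.from u) (α.from v))
                 (subst₂ _~_ (sym (α.strictlyInverseˡ u)) (sym (α.strictlyInverseˡ v)) a))
        (λ a → subst₂ _~_ (α.strictlyInverseˡ u) (α.strictlyInverseˡ v)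
                 (Equivalence.to (α.preserves (α.from u) (α.from v)) a))
    }
    where module α = Automorphism α

  infixr 9 _∘ᴬ_

  _∘ᴬ_ : Automorphism G → Automorphism G → Automorphism G
  β ∘ᴬ α = record
    { perm      = β.perm ↔-∘ α.perm
    ; preserves = λ u v → mk⇔
        (λ a → Equivalence.to (β.preserves _ _) (Equivalence.to (α.preserves u v) a))
        (λ a → Equivalence.from (α.preserves u v) (Equivalence.from (β.preserves _ _) a))
    }
    where
    module α = Automorphism α
    module β = Automorphism β

Coloring : ℕ → Graph → Set
Coloring k G = V G → Fin k

Distinguishing : ∀ {k} (G : Graph) → Coloring k G → Set
Distinguishing G c =
  (α : Automorphism G) → (∀ v → c (to α v) ≡ c v) → ∀ v → to α v ≡ v

Equivalent : ∀ {k} (G : Graph) → Coloring k G → Coloring k G → Set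
Equivalent G c₁ c₂ = Σ (Automorphism G) λ α → ∀ v → c₁ v ≡ c₂ (to α v)

-- Agda has no quotient types, so the set of equivalence classes of
-- distinguishing colorings is represented by a setoid.  The relation ignores
-- the proof that a coloring is distinguishing.
DistinguishingColorings : ℕ → Graph → Setoid 0ℓ 0ℓ
DistinguishingColorings k G = record
  { Carrier       = Σ (Coloring k G) (Distinguishing G)
  ; _≈_           = λ x y → Equivalent G (proj₁ x) (proj₁ y)
  ; isEquivalence = record
    { refl  = idᴬ , λ _ → refl
    ; sym   = λ { {x} {y} (α , e) →
        invᴬ α , λ v → trans (symAt (proj₁ y) α v) (sym (e (Automorphism.from α v))) }
    ; trans = λ { (α , e) (β , f) → β ∘ᴬ α , λ v → trans (e v) (f (to α v)) }
    }
  }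
  where
  symAt : (c : Coloring k G) (α : Automorphism G) (v : V G) →
          c v ≡ c (to α (Automorphism.from α v))
  symAt c α v = cong c (sym (Automorphism.strictlyInverseˡ α v))

-- Φ k [ G ]≔ N says that Φₖ(G) = N: there are exactly N equivalence classes.
-- Φₖ(G) is a relation rather than a function because it is a cardinality; N is
-- unique, since Fin M and Fin N are in bijection only when M ≡ N.
Φ_[_]≔_ : ℕ → Graph → ℕ → Set
Φ k [ G ]≔ N = Inverse (DistinguishingColorings k G) (setoid (Fin N))

{-# OPTIONS --safe #-}

-- Automorphisms preserve the grid distance |i - i'| + |j - j'|.  Corners are
-- the endpoints of diameters, so an automorphism permutes them; as m ≠ n, one
-- fixing the corner (0,0) also fixes (0,n-1), and a vertex is determined by
-- its distances to these two.  Hence the automorphisms are the four reflections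
-- (i,j) ↦ (±i,±j), and a coloring is distinguishing iff none of the three
-- nontrivial ones fixes it.  The Klein four-group acts freely on the
-- distinguishing colorings, so their number is 4 Φ, and inclusion-exclusion
-- computes it from the numbers of colorings fixed by each reflection.
module Submission where

open import Data.Bool using (Bool; true; false; not; _xor_)
import Data.Bool as Bool
open import Data.Bool.Properties using (xor-comm; xor-same)
open import Data.Fin using (Fin; zero; suc; toℕ; fromℕ; fromℕ<; inject₁; inject≤; opposite; combine; remQuot; finToFun; funToFin)
open import Data.Fin.Permutation using (permutation)
import Data.Fin.Properties as Fin
open import Data.Integer using (+_; _-_)
import Data.Integer as ℤ
import Data.Integer.Properties as ℤ
import Data.Integer.Tactic.RingSolver as ℤ-Solver
open import Data.Nat using (ℕ; zero; suc; _≤_; _<_; _+_; _*_; _∸_; _^_; ∣_-_∣; ⌊_/2⌋; ⌈_/2⌉; s≤s; _<?_)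
open import Data.Nat.Properties hiding (⊓-comm; ⊓-sel)
open import Data.Nat.Tactic.RingSolver using (solve-∀)
open import Data.Product using (∃-syntax; ∃₂; _×_; _,_; proj₁; proj₂; map; map₂)
open import Data.Rational using (_/_)
import Data.Rational.Properties as ℚ
open import Data.Rational.Unnormalised using (mkℚᵘ; *≡*)
open import Data.Sum using (_⊎_; inj₁; inj₂)
import Data.Sum as Sum
open import Function using (_∘_; mk⇔; mk↔ₛ′; Equivalence)
open import Relation.Binary.Bundles using (Setoid)
open import Relation.Binary.PropositionalEquality using (_≡_; _≢_; _≗_; refl; sym; trans; cong; cong₂; subst; subst₂; module ≡-Reasoning)
open import Relation.Nullary using (¬_; Dec; yes; no; ¬?; _×-dec_; contradiction)
open import Relation.Unary using (Decidable)
open import Algebra.Properties.CommutativeMonoid.Sum +-0-commutativeMonoid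
  using (sum; sum-cong-≗; ∑-distrib-+; sum-permute)
open import Algebra.Properties.CommutativeSemigroup +-commutativeSemigroup using (interchange)
open import Defs

open Automorphism using (to; preserves; strictlyInverseʳ)

-- Automorphisms of the grid

Vertex : ℕ → ℕ → Set
Vertex m n = Fin m × Fin n

private
  _~_ : ∀ {m n} → Vertex m n → Vertex m n → Set
  _~_ {m} {n} = Graph._~_ (P m □ P n)

flip : ∀ {n} → Bool → Fin n → Fin n
flip false i = i
flip true  i = opposite i

reflect : ∀ {m n} → Bool → Bool → Vertex m n → Vertex m n
reflect s t (i , j) = flip s i , flip t j

-- The Booleans stand for the group of order two with `false` as identity, so composition of
-- reflections becomes `xor`.
flip-∘ : ∀ {n} s s′ (i : Fin n) → flip s′ (flip s i) ≡ flip (s xor s′) i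
flip-∘ false s′    i = refl
flip-∘ true  false i = refl
flip-∘ true  true  i = Fin.opposite-involutive i

flip-involutive : ∀ {n} s (i : Fin n) → flip s (flip s i) ≡ i
flip-involutive false i = refl
flip-involutive true  i = Fin.opposite-involutive i

reflect-∘ : ∀ {m n} s t s′ t′ (v : Vertex m n) →
            reflect s′ t′ (reflect s t v) ≡ reflect (s xor s′) (t xor t′) v
reflect-∘ s t s′ t′ (i , j) = cong₂ _,_ (flip-∘ s s′ i) (flip-∘ t t′ j)

reflect-involutive : ∀ {m n} s t (v : Vertex m n) → reflect s t (reflect s t v) ≡ v
reflect-involutive s t (i , j) = cong₂ _,_ (flip-involutive s i) (flip-involutive t j)

-- The additive form lets later arguments cancel a summand instead of handling truncated
-- subtraction.
toℕ-opposite : ∀ {n} (i : Fin n) → suc (toℕ i + toℕ (opposite i)) ≡ n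
toℕ-opposite {n} i = trans (cong (_+_ (suc (toℕ i))) (Fin.opposite-prop i)) (m+[n∸m]≡n (Fin.toℕ<n i))

opposite-~ : ∀ {n} (i j : Fin n) → toℕ j ≡ suc (toℕ i) → toℕ (opposite i) ≡ suc (toℕ (opposite j))
opposite-~ {n} i j j≡1+i = +-cancelˡ-≡ (suc (toℕ i)) _ _ (begin
  suc (toℕ i) + toℕ (opposite i)        ≡⟨ toℕ-opposite i ⟩
  n                                     ≡⟨ toℕ-opposite j ⟨
  suc (toℕ j) + toℕ (opposite j)        ≡⟨ cong (λ x → suc x + toℕ (opposite j)) j≡1+i ⟩
  suc (suc (toℕ i)) + toℕ (opposite j)  ≡⟨ +-suc (suc (toℕ i)) _ ⟨
  suc (toℕ i) + suc (toℕ (opposite j))  ∎)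
  where open ≡-Reasoning

flip-~ : ∀ {n} s (i j : Fin n) → Graph._~_ (P n) i j → Graph._~_ (P n) (flip s i) (flip s j)
flip-~ false i j i~j          = i~j
flip-~ true  i j (inj₁ j≡1+i) = inj₂ (opposite-~ i j j≡1+i)
flip-~ true  i j (inj₂ i≡1+j) = inj₁ (opposite-~ j i i≡1+j)

reflect-~ : ∀ {m n} s t (u v : Vertex m n) → u ~ v → reflect s t u ~ reflect s t v
reflect-~ s t u v (inj₁ (i≡i′ , j~j′)) = inj₁ (cong (flip s) i≡i′ , flip-~ t _ _ j~j′)
reflect-~ s t u v (inj₂ (i~i′ , j≡j′)) = inj₂ (flip-~ s _ _ i~i′ , cong (flip t) j≡j′)

reflectᴬ : ∀ {m n} → Bool → Bool → Automorphism (P m □ P n)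
reflectᴬ s t = record
  { perm      = mk↔ₛ′ (reflect s t) (reflect s t) (reflect-involutive s t) (reflect-involutive s t)
  ; preserves = λ u v → mk⇔ (reflect-~ s t u v)
      (λ a → subst₂ _~_ (reflect-involutive s t u) (reflect-involutive s t v)
               (reflect-~ s t (reflect s t u) (reflect s t v) a))
  }

-- The grid distance and its invariance under automorphisms

distance : ∀ {m n} → Vertex m n → Vertex m n → ℕ
distance (i , j) (i′ , j′) = ∣ toℕ i - toℕ i′ ∣ + ∣ toℕ j - toℕ j′ ∣

distance≡0 : ∀ {m n} (u v : Vertex m n) → distance u v ≡ 0 → u ≡ v
distance≡0 (i , j) (i′ , j′) d≡0 = cong₂ _,_
  (Fin.toℕ-injective (∣m-n∣≡0⇒m≡n (m+n≡0⇒m≡0 _ d≡0)))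
  (Fin.toℕ-injective (∣m-n∣≡0⇒m≡n (m+n≡0⇒n≡0 ∣ toℕ i - toℕ i′ ∣ d≡0)))

distance-refl : ∀ {m n} (u : Vertex m n) → distance u u ≡ 0
distance-refl (i , j) = cong₂ _+_ (∣n-n∣≡0 (toℕ i)) (∣n-n∣≡0 (toℕ j))

distance-triangle : ∀ {m n} (u v w : Vertex m n) → distance u w ≤ distance u v + distance v w
distance-triangle (i , j) (i′ , j′) (i″ , j″) = begin
  ∣ toℕ i - toℕ i″ ∣ + ∣ toℕ j - toℕ j″ ∣
    ≤⟨ +-mono-≤ (∣-∣-triangle (toℕ i) (toℕ i′) (toℕ i″)) (∣-∣-triangle (toℕ j) (toℕ j′) (toℕ j″)) ⟩
  (∣ toℕ i - toℕ i′ ∣ + ∣ toℕ i′ - toℕ i″ ∣) + (∣ toℕ j - toℕ j′ ∣ + ∣ toℕ j′ - toℕ j″ ∣)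
    ≡⟨ interchange ∣ toℕ i - toℕ i′ ∣ ∣ toℕ i′ - toℕ i″ ∣ _ _ ⟩
  (∣ toℕ i - toℕ i′ ∣ + ∣ toℕ j - toℕ j′ ∣) + (∣ toℕ i′ - toℕ i″ ∣ + ∣ toℕ j′ - toℕ j″ ∣) ∎
  where open ≤-Reasoning

path-~⇒distance≡1 : ∀ {n} (i j : Fin n) → Graph._~_ (P n) i j → ∣ toℕ i - toℕ j ∣ ≡ 1
path-~⇒distance≡1 i j (inj₁ j≡1+i) =
  trans (cong (∣ toℕ i -_∣) (trans j≡1+i (+-comm 1 _))) (∣m-m+n∣≡n (toℕ i) 1)
path-~⇒distance≡1 i j (inj₂ i≡1+j) =
  trans (∣-∣-comm (toℕ i) (toℕ j)) (path-~⇒distance≡1 j i (inj₁ i≡1+j))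

~⇒distance≡1 : ∀ {m n} (u v : Vertex m n) → u ~ v → distance u v ≡ 1
~⇒distance≡1 (i , j) (_ , j′) (inj₁ (refl , j~j′)) =
  cong₂ _+_ (∣n-n∣≡0 (toℕ i)) (path-~⇒distance≡1 j j′ j~j′)
~⇒distance≡1 (i , j) (i′ , _) (inj₂ (i~i′ , refl)) =
  cong₂ _+_ (path-~⇒distance≡1 i i′ i~i′) (∣n-n∣≡0 (toℕ j))

path-step : ∀ {n p} (i j : Fin n) → ∣ toℕ i - toℕ j ∣ ≡ suc p →
            ∃[ l ] Graph._~_ (P n) i l × ∣ toℕ l - toℕ j ∣ ≡ p
path-step {suc (suc n)} zero    (suc j) refl = suc zero , inj₁ refl , refl
path-step               (suc i) zero    refl =
  inject₁ i , inj₂ (cong suc (sym (Fin.toℕ-inject₁ i))) , trans (∣-∣-identityʳ _) (Fin.toℕ-inject₁ i)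
path-step               (suc i) (suc j) eq   with l , i~l , d ← path-step i j eq =
  suc l , Sum.map (cong suc) (cong suc) i~l , d

-- The first edge of a geodesic: move in the first coordinate while it differs, afterwards in the
-- second.
step : ∀ {m n p} (u v : Vertex m n) → distance u v ≡ suc p →
       ∃[ w ] u ~ w × distance w v ≡ p
step (i , j) (i′ , j′) eq with ∣ toℕ i - toℕ i′ ∣ in eqᵢ
... | suc q with l , i~l , d ← path-step i i′ eqᵢ =
  (l , j) , inj₂ (i~l , refl) , trans (cong (_+ _) d) (suc-injective eq)
... | zero  with l , j~l , d ← path-step j j′ eq =
  (i , l) , inj₁ (refl , j~l) , cong₂ _+_ eqᵢ d

-- Induction along a geodesic from `u` to `v`: each of its `p` edges is sent to an edge, which
-- contributes 1 to the triangle inequality.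
~-preserving⇒nonexpansive :
  ∀ {m n} (f : Vertex m n → Vertex m n) → (∀ u v → u ~ v → f u ~ f v) →
  ∀ p u v → distance u v ≡ p → distance (f u) (f v) ≤ p
~-preserving⇒nonexpansive f f-~ zero    u v d≡p
  rewrite distance≡0 u v d≡p = ≤-reflexive (distance-refl (f v))
~-preserving⇒nonexpansive f f-~ (suc p) u v d≡p with w , u~w , d ← step u v d≡p = begin
  distance (f u) (f v)                         ≤⟨ distance-triangle (f u) (f w) (f v) ⟩
  distance (f u) (f w) + distance (f w) (f v)  ≤⟨ +-mono-≤ (≤-reflexive (~⇒distance≡1 _ _ (f-~ u w u~w)))
                                                           (~-preserving⇒nonexpansive f f-~ p w v d) ⟩
  suc p                                        ∎
  where open ≤-Reasoning

-- Neither the automorphism nor its inverse increases distances.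
automorphism-isometry : ∀ {m n} (α : Automorphism (P m □ P n)) u v →
                        distance (to α u) (to α v) ≡ distance u v
automorphism-isometry {m} {n} α u v = ≤-antisym (nonexpansive α u v)
  (subst₂ (λ x y → distance x y ≤ distance (to α u) (to α v))
    (strictlyInverseʳ α u) (strictlyInverseʳ α v) (nonexpansive (invᴬ α) (to α u) (to α v)))
  where
  nonexpansive : ∀ (β : Automorphism (P m □ P n)) x y → distance (to β x) (to β y) ≤ distance x y
  nonexpansive β x y = ~-preserving⇒nonexpansive (to β)
    (λ x y → Equivalence.to (preserves β x y)) _ x y refl

path-distance≤ : ∀ {n} (i j : Fin (suc n)) → ∣ toℕ i - toℕ j ∣ ≤ n
path-distance≤ i j = ≤-trans (∣m-n∣≤m⊔n (toℕ i) (toℕ j))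
  (⊔-lub (≤-pred (Fin.toℕ<n i)) (≤-pred (Fin.toℕ<n j)))

path-antipodal : ∀ {n} (i j : Fin (suc n)) → ∣ toℕ i - toℕ j ∣ ≡ n → ∃[ s ] i ≡ flip s zero
path-antipodal         zero    j       eq = false , refl
path-antipodal {suc n} (suc i) zero    eq = true , Fin.toℕ-injective (trans eq (sym (Fin.toℕ-fromℕ _)))
-- Two nonzero indices lie in a path with one vertex fewer, where the full distance cannot occur.
path-antipodal {suc n} (suc i) (suc j) eq =
  contradiction (subst (_≤ n) eq (path-distance≤ i j)) 1+n≰n

+-≤-extremal : ∀ {a b m n} → a ≤ m → b ≤ n → a + b ≡ m + n → a ≡ m × b ≡ n
+-≤-extremal {a} {b} {m} {n} a≤m b≤n eq =
  a≡m , +-cancelˡ-≡ a b n (trans eq (cong (_+ n) (sym a≡m)))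
  where
  a≡m : a ≡ m
  a≡m = ≤-antisym a≤m (+-cancelʳ-≤ n m a (≤-trans (≤-reflexive (sym eq)) (+-monoʳ-≤ a b≤n)))

-- A distance equal to the diameter `m + n` forces the maximum in each coordinate separately, so `u`
-- is a corner, and the corners are the images of (0,0) under the reflections.
antipodal : ∀ {m n} (u v : Vertex (suc m) (suc n)) → distance u v ≡ m + n →
            ∃₂ λ s t → u ≡ reflect s t (zero , zero)
antipodal (i , j) (i′ , j′) eq
  with dᵢ , dⱼ ← +-≤-extremal (path-distance≤ i i′) (path-distance≤ j j′) eq
  with s , i≡ ← path-antipodal i i′ dᵢ | t , j≡ ← path-antipodal j j′ dⱼ =
  s , t , cong₂ _,_ i≡ j≡

-- Corners and the classification of automorphisms

module _ {m n : ℕ} where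

  private
    o p q z : Vertex (suc m) (suc n)
    o = zero , zero
    p = zero , fromℕ n
    q = fromℕ m , zero
    z = fromℕ m , fromℕ n

  distance-o-z : distance o z ≡ m + n
  distance-o-z = cong₂ _+_ (Fin.toℕ-fromℕ m) (Fin.toℕ-fromℕ n)

  distance-p-q : distance p q ≡ m + n
  distance-p-q = cong₂ _+_ (Fin.toℕ-fromℕ m) (trans (∣-∣-identityʳ _) (Fin.toℕ-fromℕ n))

  -- The distances to the two corners are i + j and i + (n - j), with sum 2 i + n.
  two-corners-resolve : ∀ (u v : Vertex (suc m) (suc n)) →
                        distance o u ≡ distance o v → distance p u ≡ distance p v → u ≡ v
  two-corners-resolve (i , j) (i′ , j′) dₒ dₚ =
    cong₂ _,_ (Fin.toℕ-injective i≡i′) (Fin.toℕ-injective j≡j′)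
    where
    complement : ∀ (l : Fin (suc n)) → ∣ toℕ (fromℕ n) - toℕ l ∣ + toℕ l ≡ n
    complement l = begin
      ∣ toℕ (fromℕ n) - toℕ l ∣ + toℕ l  ≡⟨ cong (λ x → ∣ x - toℕ l ∣ + toℕ l) (Fin.toℕ-fromℕ n) ⟩
      ∣ n - toℕ l ∣ + toℕ l              ≡⟨ cong (_+ toℕ l) (∣-∣-comm n (toℕ l)) ⟩
      ∣ toℕ l - n ∣ + toℕ l              ≡⟨ cong (_+ toℕ l) (m≤n⇒∣m-n∣≡n∸m l≤n) ⟩
      n ∸ toℕ l + toℕ l                  ≡⟨ m∸n+n≡m l≤n ⟩
      n                                  ∎
      where
      open ≡-Reasoning
      l≤n : toℕ l ≤ n
      l≤n = ≤-pred (Fin.toℕ<n l)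
    regroup : ∀ a b c → (a + b) + (a + c) ≡ 2 * a + (c + b)
    regroup = solve-∀
    double : ∀ (x : Fin (suc m)) (y : Fin (suc n)) → distance o (x , y) + distance p (x , y) ≡ 2 * toℕ x + n
    double x y = trans (regroup (toℕ x) (toℕ y) _) (cong (_+_ (2 * toℕ x)) (complement y))
    i≡i′ : toℕ i ≡ toℕ i′
    i≡i′ = *-cancelˡ-≡ _ _ 2 (+-cancelʳ-≡ n _ _
             (trans (sym (double i j)) (trans (cong₂ _+_ dₒ dₚ) (double i′ j′))))
    j≡j′ : toℕ j ≡ toℕ j′
    j≡j′ = +-cancelˡ-≡ (toℕ i) _ _ (trans dₒ (cong (_+ toℕ j′) (sym i≡i′)))

  module _ (m≢0 : m ≢ 0) (n≢0 : n ≢ 0) (m≢n : m ≢ n) where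

    -- The four corners lie at distances 0, `n`, `m` and `m + n` from (0,0). As `m` and `n` are
    -- nonzero and distinct, the value `n` occurs only once.
    corner-at-distance-n : ∀ s t → distance o (reflect s t o) ≡ n → reflect s t o ≡ p
    corner-at-distance-n false false d≡n = contradiction (sym d≡n) n≢0
    corner-at-distance-n false true  d≡n = refl
    corner-at-distance-n true  false d≡n =
      contradiction (trans (sym (trans (+-identityʳ _) (Fin.toℕ-fromℕ m))) d≡n) m≢n
    corner-at-distance-n true  true  d≡n =
      contradiction (+-cancelʳ-≡ n m 0 (trans (sym distance-o-z) d≡n)) m≢0

    automorphism-fixing-corner : (α : Automorphism (P (suc m) □ P (suc n))) →
                                 to α o ≡ o → ∀ v → to α v ≡ v
    automorphism-fixing-corner α αo≡o v = two-corners-resolve (to α v) v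
      (fixed-isometry o αo≡o v) (fixed-isometry p αp≡p v)
      where
      fixed-isometry : ∀ u → to α u ≡ u → ∀ v → distance u (to α v) ≡ distance u v
      fixed-isometry u αu≡u v =
        trans (cong (λ x → distance x (to α v)) (sym αu≡u)) (automorphism-isometry α u v)
      αp≡p : to α p ≡ p
      -- `p` and `q` span a diameter, so the image of `p` is a corner. It still has distance `n`
      -- from the fixed corner `o`, which singles out `p`.
      αp≡p with s , t , αp≡ ← antipodal (to α p) (to α q) (trans (automorphism-isometry α p q) distance-p-q) =
        trans αp≡ (corner-at-distance-n s t
          (trans (cong (distance o) (sym αp≡)) (trans (fixed-isometry o αo≡o p) (Fin.toℕ-fromℕ n))))

    -- The image of (0,0) is a corner, which some reflection carries back. The composite fixes
    -- (0,0), hence is the identity, and a reflection is its own inverse.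
    automorphism⇒reflect : (α : Automorphism (P (suc m) □ P (suc n))) →
                           ∃₂ λ s t → ∀ v → to α v ≡ reflect s t v
    automorphism⇒reflect α
      with s , t , αo≡ ← antipodal (to α o) (to α z) (trans (automorphism-isometry α o z) distance-o-z) =
      s , t , λ v → trans (sym (reflect-involutive s t (to α v)))
        (cong (reflect s t) (automorphism-fixing-corner (reflectᴬ s t ∘ᴬ α)
          (trans (cong (reflect s t) αo≡) (reflect-involutive s t o)) v))

    reflect-faithful : ∀ s t → (∀ (v : Vertex (suc m) (suc n)) → reflect s t v ≡ v) →
                       s ≡ false × t ≡ false
    reflect-faithful s t fixes = flip-faithful m≢0 s (cong proj₁ (fixes o)) ,
      flip-faithful n≢0 t (cong proj₂ (fixes o))
      where
      flip-faithful : ∀ {l} → l ≢ 0 → ∀ s → flip {suc l} s zero ≡ zero → s ≡ false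
      flip-faithful l≢0 false _      = refl
      flip-faithful l≢0 true  last≡0 = contradiction (trans (sym (Fin.toℕ-fromℕ _)) (cong toℕ last≡0)) l≢0

-- Counting orbits of a Klein four-group action

-- The Iverson bracket: it turns cardinalities into sums, so that counting arguments reduce to
-- pointwise identities.
⟦_⟧ : ∀ {A : Set} → Dec A → ℕ
⟦ yes _ ⟧ = 1
⟦ no  _ ⟧ = 0

⟦⟧-cong : ∀ {A B : Set} (a? : Dec A) (b? : Dec B) → (A → B) → (B → A) → ⟦ a? ⟧ ≡ ⟦ b? ⟧
⟦⟧-cong (yes a) (yes b) f g = refl
⟦⟧-cong (yes a) (no ¬b) f g = contradiction (f a) ¬b
⟦⟧-cong (no ¬a) (yes b) f g = contradiction (g b) ¬a
⟦⟧-cong (no ¬a) (no ¬b) f g = refl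

count : ∀ {K} {Q : Fin K → Set} → Decidable Q → ℕ
count Q? = sum (λ x → ⟦ Q? x ⟧)

sum-ones : ∀ K → sum {K} (λ _ → 1) ≡ K
sum-ones zero    = refl
sum-ones (suc K) = cong suc (sum-ones K)

sum-distrib-+₃ : ∀ {K} (f g h : Fin K → ℕ) → sum (λ x → f x + g x + h x) ≡ sum f + sum g + sum h
sum-distrib-+₃ f g h = trans (∑-distrib-+ (λ x → f x + g x) h) (cong (_+ sum h) (∑-distrib-+ f g))

sum-involution : ∀ {K} (f : Fin K → ℕ) (g : Fin K → Fin K) → (∀ x → g (g x) ≡ x) → sum (f ∘ g) ≡ sum f
sum-involution f g g² = sym (sum-permute f (permutation g g g² g²))

-- Enumerations of subsets of a finite set

record Enumeration {K : ℕ} (Q : Fin K → Set) (N : ℕ) : Set where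
  field
    index           : Fin N → Fin K
    index-satisfies : ∀ y → Q (index y)
    index-injective : ∀ {y z} → index y ≡ index z → y ≡ z
    rank            : ∀ {x} → Q x → Fin N
    index-rank      : ∀ {x} (q : Q x) → index (rank q) ≡ x

  -- In particular `rank` does not depend on the proof of membership, although proofs of `Q x` may
  -- differ.
  rank-cong : ∀ {x y} (p : Q x) (q : Q y) → x ≡ y → rank p ≡ rank q
  rank-cong p q x≡y = index-injective (trans (index-rank p) (trans x≡y (sym (index-rank q))))

  rank-index : ∀ {y} (q : Q (index y)) → rank q ≡ y
  rank-index q = index-injective (index-rank q)

enumerate : ∀ {K} {Q : Fin K → Set} (Q? : Decidable Q) → Enumeration Q (count Q?)
enumerate {zero} Q? = record
  { index           = λ ()
  ; index-satisfies = λ ()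
  ; index-injective = λ { {()} }
  ; rank            = λ { {()} }
  ; index-rank      = λ { {()} }
  }
enumerate {suc K} {Q} Q? with Q? zero | enumerate (Q? ∘ suc)
... | yes q₀ | E = record
  { index           = λ { zero → zero ; (suc y) → suc (index y) }
  ; index-satisfies = λ { zero → q₀ ; (suc y) → index-satisfies y }
  ; index-injective = λ { {zero} {zero} _ → refl
                        ; {suc y} {suc z} e → cong suc (index-injective (Fin.suc-injective e)) }
  ; rank            = λ { {zero} _ → zero ; {suc x} q → suc (rank q) }
  ; index-rank      = λ { {zero} _ → refl ; {suc x} q → cong suc (index-rank q) }
  }
  where open Enumeration E
... | no ¬q₀ | E = record
  { index           = suc ∘ index
  ; index-satisfies = index-satisfies
  ; index-injective = index-injective ∘ Fin.suc-injective
  ; rank            = λ { {zero} q → contradiction q ¬q₀ ; {suc x} q → rank q }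
  ; index-rank      = λ { {zero} q → contradiction q ¬q₀ ; {suc x} q → cong suc (index-rank q) }
  }
  where open Enumeration E

enumeration-≤ : ∀ {K} {Q : Fin K → Set} {M N} → Enumeration Q M → Enumeration Q N → M ≤ N
enumeration-≤ E F = Fin.injective⇒≤ {f = λ y → F.rank (E.index-satisfies y)} λ eq →
  E.index-injective (trans (sym (F.index-rank _)) (trans (cong F.index eq) (F.index-rank _)))
  where
  module E = Enumeration E
  module F = Enumeration F

-- Enumerations of the same set have the same length, so a count can be read off from any explicit
-- bijection.
count-enumeration : ∀ {K} {Q : Fin K → Set} {N} (Q? : Decidable Q) → Enumeration Q N → count Q? ≡ N
count-enumeration Q? E = ≤-antisym (enumeration-≤ (enumerate Q?) E) (enumeration-≤ E (enumerate Q?))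

-- Free orbits and their canonical points

module KleinAction {K : ℕ} (act : Bool → Bool → Fin K → Fin K)
  (act-id : ∀ x → act false false x ≡ x)
  (act-∘  : ∀ s t s′ t′ x → act s t (act s′ t′ x) ≡ act (s xor s′) (t xor t′) x) where

  open import Algebra.Construct.NaturalChoice.Min (Fin.≤-totalOrder K)
    using (_⊓_; ⊓-comm; ⊓-sel)

  act-involutive : ∀ s t x → act s t (act s t x) ≡ x
  act-involutive s t x = trans (act-∘ s t s t x)
    (trans (cong₂ (λ s t → act s t x) (xor-same s) (xor-same t)) (act-id x))

  act-comm : ∀ s t s′ t′ x → act s t (act s′ t′ x) ≡ act s′ t′ (act s t x)
  act-comm s t s′ t′ x = trans (act-∘ s t s′ t′ x)
    (trans (cong₂ (λ s t → act s t x) (xor-comm s s′) (xor-comm t t′)) (sym (act-∘ s′ t′ s t x)))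

  act-injective : ∀ s t {x y} → act s t x ≡ act s t y → x ≡ y
  act-injective s t {x} {y} eq =
    trans (sym (act-involutive s t x)) (trans (cong (act s t) eq) (act-involutive s t y))

  Fixed : Bool → Bool → Fin K → Set
  Fixed s t x = act s t x ≡ x

  fixed? : ∀ s t → Decidable (Fixed s t)
  fixed? s t x = act s t x Fin.≟ x

  -- The group is abelian, so stabilizers are constant along orbits.
  fixed-act : ∀ s t s′ t′ x → Fixed s t (act s′ t′ x) → Fixed s t x
  fixed-act s t s′ t′ x fix = act-injective s′ t′ (trans (act-comm s′ t′ s t x) fix)

  fixed-xor : ∀ s t s′ t′ {x} → Fixed s t x → Fixed s′ t′ x → Fixed (s xor s′) (t xor t′) x
  fixed-xor s t s′ t′ {x} fix fix′ =
    trans (sym (act-∘ s t s′ t′ x)) (trans (cong (act s t) fix′) fix)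

  Free : Fin K → Set
  Free x = ¬ Fixed true false x × ¬ Fixed false true x × ¬ Fixed true true x

  free? : Decidable Free
  free? x = ¬? (fixed? true false x) ×-dec (¬? (fixed? false true x) ×-dec ¬? (fixed? true true x))

  -- The two elements named here generate the group, so these are the points fixed by every element.
  FixedByAll : Fin K → Set
  FixedByAll x = Fixed true false x × Fixed false true x

  fixedByAll? : Decidable FixedByAll
  fixedByAll? x = fixed? true false x ×-dec fixed? false true x

  free-act : ∀ s t {x} → Free x → Free (act s t x)
  free-act s t {x} (a , b , c) =
    a ∘ fixed-act true false s t x , b ∘ fixed-act false true s t x , c ∘ fixed-act true true s t x

  free-act⁻¹ : ∀ s t {x} → Free (act s t x) → Free x
  free-act⁻¹ s t {x} free = subst Free (act-involutive s t x) (free-act s t free)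

  free-fixed : ∀ s t {x} → Free x → Fixed s t x → s ≡ false × t ≡ false
  free-fixed false false _           _   = refl , refl
  free-fixed true  false (a , _ , _) fix = contradiction fix a
  free-fixed false true  (_ , b , _) fix = contradiction fix b
  free-fixed true  true  (_ , _ , c) fix = contradiction fix c

  xor≡false⇒≡ : ∀ s t → s xor t ≡ false → s ≡ t
  xor≡false⇒≡ false false _ = refl
  xor≡false⇒≡ true  true  _ = refl

  free-act-injective : ∀ s t s′ t′ {x} → Free x → act s t x ≡ act s′ t′ x → s ≡ s′ × t ≡ t′
  free-act-injective s t s′ t′ {x} free eq
    with s⊕s′ , t⊕t′ ← free-fixed (s xor s′) (t xor t′) free
           (trans (sym (act-∘ s t s′ t′ x)) (trans (cong (act s t) (sym eq)) (act-involutive s t x))) =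
    xor≡false⇒≡ s s′ s⊕s′ , xor≡false⇒≡ t t′ t⊕t′

  abstract
    -- An orbit is represented by its minimum. The four entries are bracketed in pairs to match the
    -- two generators, and only the swap and selection laws below are visible outside the abstract
    -- block.
    min₄ : Fin K → Fin K → Fin K → Fin K → Fin K
    min₄ a b c d = (a ⊓ b) ⊓ (c ⊓ d)

    min₄-swapᵢ : ∀ a b c d → min₄ b a d c ≡ min₄ a b c d
    min₄-swapᵢ a b c d = cong₂ _⊓_ (⊓-comm b a) (⊓-comm d c)

    min₄-swapₒ : ∀ a b c d → min₄ c d a b ≡ min₄ a b c d
    min₄-swapₒ a b c d = ⊓-comm (c ⊓ d) (a ⊓ b)

    min₄-sel : (f : Bool → Bool → Fin K) →
               ∃₂ λ s t → min₄ (f false false) (f true false) (f false true) (f true true) ≡ f s t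
    min₄-sel f
      with ⊓-sel (f false false) (f true false) | ⊓-sel (f false true) (f true true)
         | ⊓-sel (f false false ⊓ f true false) (f false true ⊓ f true true)
    ... | inj₁ e | _      | inj₁ e′ = false , false , trans e′ e
    ... | inj₂ e | _      | inj₁ e′ = true  , false , trans e′ e
    ... | _      | inj₁ e | inj₂ e′ = false , true  , trans e′ e
    ... | _      | inj₂ e | inj₂ e′ = true  , true  , trans e′ e

  representative : Fin K → Fin K
  representative x = min₄ (act false false x) (act true false x) (act false true x) (act true true x)

  representative-orbit : ∀ x → ∃₂ λ s t → representative x ≡ act s t x
  representative-orbit x = min₄-sel (λ s t → act s t x)

  -- Acting permutes the orbit: `s` exchanges the entries within each pair and `t` exchanges the
  -- pairs, and the minimum is symmetric under both.
  representative-act : ∀ s t x → representative (act s t x) ≡ representative x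
  representative-act s t x
    rewrite act-∘ false false s t x | act-∘ true false s t x
          | act-∘ false true s t x | act-∘ true true s t x = permuted s t
    where
    e a b c : Fin K
    e = act false false x
    a = act true false x
    b = act false true x
    c = act true true x
    permuted : ∀ s t → min₄ (act s t x) (act (not s) t x) (act s (not t) x) (act (not s) (not t) x)
                     ≡ representative x
    permuted false false = refl
    permuted true  false = min₄-swapᵢ e a b c
    permuted false true  = min₄-swapₒ e a b c
    permuted true  true  = trans (min₄-swapᵢ b c e a) (min₄-swapₒ e a b c)

  -- Every free orbit contains exactly one such point, so counting them counts the free orbits.
  Canonical : Fin K → Set
  Canonical x = Free x × representative x ≡ x

  canonical? : Decidable Canonical
  canonical? x = free? x ×-dec (representative x Fin.≟ x)

  canonical-representative : ∀ {x} → Free x → Canonical (representative x)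
  canonical-representative {x} free = let s , t , eq = representative-orbit x in
    subst Free (sym eq) (free-act s t free) ,
    trans (cong representative eq) (representative-act s t x)

  orbit-sum : (Fin K → ℕ) → Fin K → ℕ
  orbit-sum f x = (f (act false false x) + f (act true false x)) + (f (act false true x) + f (act true true x))

  -- Among the four translates of a free point exactly one is canonical; no translate of a non-free
  -- point is free, hence none is canonical.
  free≡orbit-sum-canonical : ∀ x → ⟦ free? x ⟧ ≡ orbit-sum (λ y → ⟦ canonical? y ⟧) x
  free≡orbit-sum-canonical x = indicator-identity
    where
    _≟²_ : (a b : Bool × Bool) → Dec (proj₁ a ≡ proj₁ b × proj₂ a ≡ proj₂ b)
    (s , t) ≟² (s′ , t′) = (s Bool.≟ s′) ×-dec (t Bool.≟ t′)

    one-of-four : ∀ s t → 1 ≡ (⟦ (s , t) ≟² (false , false) ⟧ + ⟦ (s , t) ≟² (true , false) ⟧)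
                            + (⟦ (s , t) ≟² (false , true) ⟧ + ⟦ (s , t) ≟² (true , true) ⟧)
    one-of-four false false = refl
    one-of-four false true  = refl
    one-of-four true  false = refl
    one-of-four true  true  = refl

    indicator-identity : ⟦ free? x ⟧ ≡ orbit-sum (λ y → ⟦ canonical? y ⟧) x
    indicator-identity with free? x
    ... | no ¬free = sym (cong₂ _+_ (cong₂ _+_ (none false false) (none true false))
                                    (cong₂ _+_ (none false true) (none true true)))
      where
      none : ∀ s t → ⟦ canonical? (act s t x) ⟧ ≡ 0
      none s t with canonical? (act s t x)
      ... | yes (free , _) = contradiction (free-act⁻¹ s t free) ¬free
      ... | no _           = refl
    ... | yes free with s , t , eq ← representative-orbit x =
      trans (one-of-four s t) (cong₂ _+_ (cong₂ _+_ (same false false) (same true false))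
                                         (cong₂ _+_ (same false true) (same true true)))
      where
      -- The orbit minimum is attained at `(s , t)`, and by freeness at no other group element.
      same : ∀ s′ t′ → ⟦ (s , t) ≟² (s′ , t′) ⟧ ≡ ⟦ canonical? (act s′ t′ x) ⟧
      same s′ t′ = ⟦⟧-cong ((s , t) ≟² (s′ , t′)) (canonical? (act s′ t′ x))
        (λ { (refl , refl) → free-act s t free , trans (representative-act s t x) eq })
        (λ { (_ , e) → free-act-injective s t s′ t′ free
               (trans (sym eq) (trans (sym (representative-act s′ t′ x)) e)) })

  -- Each group element permutes `Fin K`, so each of the four translated sums equals `sum f`.
  sum-orbit-sum : ∀ f → sum (orbit-sum f) ≡ 4 * sum f
  sum-orbit-sum f = begin
    sum (orbit-sum f)
      ≡⟨ ∑-distrib-+ (λ x → f (act false false x) + f (act true false x))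
           (λ x → f (act false true x) + f (act true true x)) ⟩
    sum (λ x → f (act false false x) + f (act true false x)) + sum (λ x → f (act false true x) + f (act true true x))
      ≡⟨ cong₂ _+_ (∑-distrib-+ (f ∘ act false false) (f ∘ act true false))
           (∑-distrib-+ (f ∘ act false true) (f ∘ act true true)) ⟩
    (sum (f ∘ act false false) + sum (f ∘ act true false)) + (sum (f ∘ act false true) + sum (f ∘ act true true))
      ≡⟨ cong₂ _+_ (cong₂ _+_ (invariant false false) (invariant true false))
           (cong₂ _+_ (invariant false true) (invariant true true)) ⟩
    (sum f + sum f) + (sum f + sum f)
      ≡⟨ fourfold (sum f) ⟩
    4 * sum f ∎
    where
    open ≡-Reasoning
    invariant : ∀ s t → sum (f ∘ act s t) ≡ sum f
    invariant s t = sum-involution f (act s t) (act-involutive s t)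
    fourfold : ∀ a → (a + a) + (a + a) ≡ 4 * a
    fourfold = solve-∀

  count-free : count free? ≡ 4 * count canonical?
  count-free = trans (sum-cong-≗ free≡orbit-sum-canonical) (sum-orbit-sum (λ x → ⟦ canonical? x ⟧))

  -- Any two of the three involutions generate the group, so all pairwise
  -- intersections of their fixed-point sets coincide.
  inclusion-exclusion : ∀ x →
    ⟦ free? x ⟧ + (⟦ fixed? true false x ⟧ + ⟦ fixed? false true x ⟧ + ⟦ fixed? true true x ⟧)
    ≡ 1 + (⟦ fixedByAll? x ⟧ + ⟦ fixedByAll? x ⟧)
  inclusion-exclusion x with fixed? true false x | fixed? false true x | fixed? true true x
  ... | yes a | yes b | yes c = refl
  ... | yes a | yes b | no ¬c = contradiction (fixed-xor true false false true a b) ¬c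
  ... | yes a | no ¬b | yes c = contradiction (fixed-xor true false true true a c) ¬b
  ... | yes a | no ¬b | no ¬c = refl
  ... | no ¬a | yes b | yes c = contradiction (fixed-xor false true true true b c) ¬a
  ... | no ¬a | yes b | no ¬c = refl
  ... | no ¬a | no ¬b | yes c = refl
  ... | no ¬a | no ¬b | no ¬c = refl

  -- The pointwise identity summed over all points; the subtracted terms stay on the left so that
  -- everything remains in ℕ.
  count-inclusion-exclusion :
    4 * count canonical? +
      (count (fixed? true false) + count (fixed? false true) + count (fixed? true true))
    ≡ K + (count fixedByAll? + count fixedByAll?)
  count-inclusion-exclusion = begin
    4 * count canonical? + (count (fixed? true false) + count (fixed? false true) + count (fixed? true true))
      ≡⟨ cong₂ _+_ count-free (sum-distrib-+₃ a b c) ⟨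
    count free? + sum (λ x → a x + b x + c x)
      ≡⟨ ∑-distrib-+ (λ x → ⟦ free? x ⟧) (λ x → a x + b x + c x) ⟨
    sum (λ x → ⟦ free? x ⟧ + (a x + b x + c x))
      ≡⟨ sum-cong-≗ inclusion-exclusion ⟩
    sum (λ x → 1 + (d x + d x))
      ≡⟨ ∑-distrib-+ (λ _ → 1) (λ x → d x + d x) ⟩
    sum {K} (λ _ → 1) + sum (λ x → d x + d x)
      ≡⟨ cong₂ _+_ (sum-ones K) (∑-distrib-+ d d) ⟩
    K + (sum d + sum d) ∎
    where
    open ≡-Reasoning
    a b c d : Fin K → ℕ
    a x = ⟦ fixed? true false x ⟧
    b x = ⟦ fixed? false true x ⟧
    c x = ⟦ fixed? true true x ⟧
    d x = ⟦ fixedByAll? x ⟧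

-- Colorings fixed by reflections

-- With vertex (i,j) numbered n i + j, the numbers of a vertex and of its rotated image add up to n
-- (m - 1) + (n - 1) = m n - 1, which is the defining property of opposite indices.
opposite-combine : ∀ {m n} (i : Fin m) (j : Fin n) →
                   opposite (combine i j) ≡ combine (opposite i) (opposite j)
opposite-combine {m} {n} i j = Fin.toℕ-injective
  (+-cancelˡ-≡ (toℕ (combine i j)) _ _ (suc-injective (trans (toℕ-opposite (combine i j)) (sym sum≡))))
  where
  open ≡-Reasoning
  regroup : ∀ n i j i′ j′ → suc ((n * i + j) + (n * i′ + j′)) ≡ n * (i + i′) + suc (j + j′)
  regroup = solve-∀
  regroup′ : ∀ n a → n * a + n ≡ suc a * n
  regroup′ = solve-∀
  sum≡ : suc (toℕ (combine i j) + toℕ (combine (opposite i) (opposite j))) ≡ m * n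
  sum≡ = begin
    suc (toℕ (combine i j) + toℕ (combine (opposite i) (opposite j)))
      ≡⟨ cong suc (cong₂ _+_ (Fin.toℕ-combine i j) (Fin.toℕ-combine (opposite i) (opposite j))) ⟩
    suc ((n * toℕ i + toℕ j) + (n * toℕ (opposite i) + toℕ (opposite j)))
      ≡⟨ regroup n (toℕ i) _ _ _ ⟩
    n * (toℕ i + toℕ (opposite i)) + suc (toℕ j + toℕ (opposite j))
      ≡⟨ cong (_+_ (n * (toℕ i + toℕ (opposite i)))) (toℕ-opposite j) ⟩
    n * (toℕ i + toℕ (opposite i)) + n
      ≡⟨ regroup′ n _ ⟩
    suc (toℕ i + toℕ (opposite i)) * n
      ≡⟨ cong (_* n) (toℕ-opposite i) ⟩
    m * n ∎

-- Folding a path onto its first half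

⌈n/2⌉+⌈n/2⌉≤1+n : ∀ n → ⌈ n /2⌉ + ⌈ n /2⌉ ≤ suc n
⌈n/2⌉+⌈n/2⌉≤1+n n = begin
  -- At `suc n` the library inequality unfolds to `⌈ n /2⌉ ≤ suc ⌊ n /2⌋`.
  ⌈ n /2⌉ + ⌈ n /2⌉        ≤⟨ +-monoˡ-≤ ⌈ n /2⌉ (⌊n/2⌋≤⌈n/2⌉ (suc n)) ⟩
  suc (⌊ n /2⌋ + ⌈ n /2⌉)  ≡⟨ cong suc (⌊n/2⌋+⌈n/2⌉≡n n) ⟩
  suc n                    ∎
  where open ≤-Reasoning

n≤⌈n/2⌉+⌈n/2⌉ : ∀ n → n ≤ ⌈ n /2⌉ + ⌈ n /2⌉
n≤⌈n/2⌉+⌈n/2⌉ n = begin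
  n                  ≡⟨ ⌊n/2⌋+⌈n/2⌉≡n n ⟨
  ⌊ n /2⌋ + ⌈ n /2⌉  ≤⟨ +-monoˡ-≤ ⌈ n /2⌉ (⌊n/2⌋≤⌈n/2⌉ n) ⟩
  ⌈ n /2⌉ + ⌈ n /2⌉  ∎
  where open ≤-Reasoning

-- The first half, including the middle index when `n` is odd, is a set of representatives for the
-- orbits of reversal.
unfold : ∀ {n} → Fin ⌈ n /2⌉ → Fin n
unfold {n} y = inject≤ y (⌈n/2⌉≤n n)

-- An index outside the first half has its opposite inside, since the two add up to n - 1 and n is
-- at most twice ⌈n/2⌉.
unfold-orbit : ∀ {n} (j : Fin n) → ∃₂ λ s y → unfold y ≡ flip s j
unfold-orbit {n} j with toℕ j <? ⌈ n /2⌉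
... | yes j<h = false , fromℕ< j<h , Fin.toℕ-injective (trans (Fin.toℕ-inject≤ _ _) (Fin.toℕ-fromℕ< j<h))
... | no  j≮h = true , fromℕ< j′<h , Fin.toℕ-injective (trans (Fin.toℕ-inject≤ _ _) (Fin.toℕ-fromℕ< j′<h))
  where
  open ≤-Reasoning
  j′<h : toℕ (opposite j) < ⌈ n /2⌉
  j′<h = +-cancelˡ-≤ ⌈ n /2⌉ _ _ (begin
    ⌈ n /2⌉ + suc (toℕ (opposite j))  ≤⟨ +-monoˡ-≤ _ (≮⇒≥ j≮h) ⟩
    toℕ j + suc (toℕ (opposite j))    ≡⟨ +-suc (toℕ j) _ ⟩
    suc (toℕ j + toℕ (opposite j))    ≡⟨ toℕ-opposite j ⟩
    n                                 ≤⟨ n≤⌈n/2⌉+⌈n/2⌉ n ⟩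
    ⌈ n /2⌉ + ⌈ n /2⌉                 ∎)

unfold-opposite-sum : ∀ {n} (y z : Fin ⌈ n /2⌉) → unfold y ≡ opposite (unfold z) →
                      suc (toℕ y) + suc (toℕ z) ≡ suc n
unfold-opposite-sum {n} y z eq = begin
    suc (toℕ y) + suc (toℕ z)                               ≡⟨ +-comm (suc (toℕ y)) _ ⟩
    suc (toℕ z + suc (toℕ y))                               ≡⟨ cong suc (+-suc (toℕ z) (toℕ y)) ⟩
    suc (suc (toℕ z + toℕ y))
      ≡⟨ cong₂ (λ a b → suc (suc (a + b))) (Fin.toℕ-inject≤ z _) (Fin.toℕ-inject≤ y _) ⟨
    suc (suc (toℕ (unfold z) + toℕ (unfold y)))             ≡⟨ cong (λ x → suc (suc (toℕ (unfold z) + toℕ x))) eq ⟩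
    suc (suc (toℕ (unfold z) + toℕ (opposite (unfold z))))  ≡⟨ cong suc (toℕ-opposite (unfold z)) ⟩
    suc n                                                   ∎
  where open ≡-Reasoning

-- If y and z are opposite then (y + 1) + (z + 1) = n + 1 ≥ 2 ⌈n/2⌉, so both
-- are the middle index.
unfold-orbit-unique : ∀ {n} s (y z : Fin ⌈ n /2⌉) → unfold y ≡ flip s (unfold z) → y ≡ z
unfold-orbit-unique {n} false y z eq = Fin.inject≤-injective (⌈n/2⌉≤n n) (⌈n/2⌉≤n n) y z eq
unfold-orbit-unique {n} true  y z eq
  with y≡ , z≡ ← +-≤-extremal (Fin.toℕ<n y) (Fin.toℕ<n z)
                   (≤-antisym (+-mono-≤ (Fin.toℕ<n y) (Fin.toℕ<n z))
                     (≤-trans (⌈n/2⌉+⌈n/2⌉≤1+n n) (≤-reflexive (sym (unfold-opposite-sum y z eq))))) =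
  Fin.toℕ-injective (suc-injective (trans y≡ (sym z≡)))

abstract
  fold : ∀ {n} → Fin n → Fin ⌈ n /2⌉
  fold j = proj₁ (proj₂ (unfold-orbit j))

  unfold-fold : ∀ {n} (j : Fin n) → ∃[ s ] unfold (fold j) ≡ flip s j
  unfold-fold j = proj₁ (unfold-orbit j) , proj₂ (proj₂ (unfold-orbit j))

fold-unfold : ∀ {n} (y : Fin ⌈ n /2⌉) → fold (unfold y) ≡ y
fold-unfold y with s , eq ← unfold-fold (unfold y) = unfold-orbit-unique s _ y eq

fold-flip : ∀ {n} s (j : Fin n) → fold (flip s j) ≡ fold j
fold-flip s j with a , eqₐ ← unfold-fold (flip s j) | b , eq_b ← unfold-fold j =
  -- The flips lead from the representative of `j` back to `j` (by `b`), on to `flip s j` (by `s`),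
  -- and to the representative of the latter (by `a`).
  unfold-orbit-unique ((b xor s) xor a) _ _ (begin
    unfold (fold (flip s j))                        ≡⟨ eqₐ ⟩
    flip a (flip s j)                               ≡⟨ cong (flip a ∘ flip s) (flip-involutive b j) ⟨
    flip a (flip s (flip b (flip b j)))             ≡⟨ cong (flip a ∘ flip s ∘ flip b) eq_b ⟨
    flip a (flip s (flip b (unfold (fold j))))      ≡⟨ cong (flip a) (flip-∘ b s _) ⟩
    flip a (flip (b xor s) (unfold (fold j)))       ≡⟨ flip-∘ (b xor s) a _ ⟩
    flip ((b xor s) xor a) (unfold (fold j))        ∎)
  where open ≡-Reasoning

funToFin-cong : ∀ {m n} {f g : Fin m → Fin n} → f ≗ g → funToFin f ≡ funToFin g
funToFin-cong {zero}  f≗g = refl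
funToFin-cong {suc m} f≗g = cong₂ combine (f≗g zero) (funToFin-cong (f≗g ∘ suc))

-- Colorings as numbers and the counts of fixed colorings

module Colorings (m n k : ℕ) where

  abstract
    -- Colorings are functions, compared only pointwise. Numbering them supplies the decidable
    -- equality, the order and the finite sums that the orbit count relies on.
    decode : Fin (k ^ (m * n)) → Vertex m n → Fin k
    decode x (i , j) = finToFun {k} {m * n} x (combine i j)

    encode : (Vertex m n → Fin k) → Fin (k ^ (m * n))
    encode c = funToFin (c ∘ remQuot n)

    encode-cong : ∀ {c d} → c ≗ d → encode c ≡ encode d
    encode-cong c≗d = funToFin-cong (c≗d ∘ remQuot n)

    decode-encode : ∀ c → decode (encode c) ≗ c
    decode-encode c (i , j) = trans (Fin.finToFun-funToFin (c ∘ remQuot n) (combine i j))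
      (cong c (Fin.remQuot-combine i j))

    encode-decode : ∀ x → encode (decode x) ≡ x
    encode-decode x = trans
      (funToFin-cong (λ w → cong (finToFun {k} {m * n} x) (Fin.combine-remQuot {m} n w)))
      (Fin.funToFin-finToFin {m * n} {k} x)

  act : Bool → Bool → Fin (k ^ (m * n)) → Fin (k ^ (m * n))
  act s t x = encode (decode x ∘ reflect s t)

  act-∘ : ∀ s t s′ t′ x → act s t (act s′ t′ x) ≡ act (s xor s′) (t xor t′) x
  act-∘ s t s′ t′ x = encode-cong λ v → trans (decode-encode _ (reflect s t v))
    (cong (decode x) (reflect-∘ s t s′ t′ v))

  open KleinAction act encode-decode act-∘ public

  fixed⇒invariant : ∀ s t {x} → Fixed s t x → ∀ v → decode x (reflect s t v) ≡ decode x v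
  fixed⇒invariant s t fix v = trans (sym (decode-encode _ v)) (cong (λ y → decode y v) fix)

  invariant⇒fixed : ∀ s t c → (∀ v → c (reflect s t v) ≡ c v) → Fixed s t (encode c)
  invariant⇒fixed s t c inv =
    encode-cong λ v → trans (decode-encode c (reflect s t v)) (inv v)

  -- The colorings in `Q` are those that factor through the quotient map `retract`. Composing with
  -- `retract` and restricting along `section` are inverse to each other, so there are as many as
  -- colorings of `M` points.
  enumerate-invariant :
    ∀ {M} {Q : Fin (k ^ (m * n)) → Set} (retract : Vertex m n → Fin M) (section : Fin M → Vertex m n) →
    (∀ y → retract (section y) ≡ y) →
    (∀ (c : Fin M → Fin k) → Q (encode (c ∘ retract))) →
    (∀ {x} → Q x → ∀ v → decode x (section (retract v)) ≡ decode x v) →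
    Enumeration Q (k ^ M)
  enumerate-invariant {M} retract section retract-section Q-encode Q-invariant = record
    { index           = λ y → encode (finToFun {k} {M} y ∘ retract)
    ; index-satisfies = λ y → Q-encode (finToFun {k} {M} y)
    ; index-injective = λ {y} {z} eq →
        trans (sym (index-section y)) (trans (cong (λ x → funToFin (decode x ∘ section)) eq) (index-section z))
    ; rank            = λ {x} _ → funToFin (decode x ∘ section)
    ; index-rank      = λ {x} q → trans
        (encode-cong λ v → trans (Fin.finToFun-funToFin (decode x ∘ section) (retract v)) (Q-invariant q v))
        (encode-decode x)
    }
    where
    index-section : ∀ y → funToFin (decode (encode (finToFun {k} {M} y ∘ retract)) ∘ section) ≡ y
    index-section y = trans
      (funToFin-cong λ w → trans (decode-encode _ (section w)) (cong (finToFun {k} {M} y) (retract-section w)))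
      (Fin.funToFin-finToFin {M} {k} y)

  -- Here the quotient is by a single reflection: `retract` is constant on its orbits and `section`
  -- picks a vertex in each.
  enumerate-fixed :
    ∀ {M} s t (retract : Vertex m n → Fin M) (section : Fin M → Vertex m n) →
    (∀ y → retract (section y) ≡ y) →
    (∀ v → retract (reflect s t v) ≡ retract v) →
    (∀ v → section (retract v) ≡ v ⊎ section (retract v) ≡ reflect s t v) →
    Enumeration (Fixed s t) (k ^ M)
  enumerate-fixed s t retract section retract-section retract-reflect section-retract =
    enumerate-invariant retract section retract-section
      (λ c → invariant⇒fixed s t (c ∘ retract) (λ v → cong c (retract-reflect v)))
      (λ {x} fix v → Sum.[ cong (decode x)
                         , (λ eq → trans (cong (decode x) eq) (fixed⇒invariant s t fix v)) ]
                         (section-retract v))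

  -- The orbits are numbered by `j` and the folded `i`; putting `j` first gives the exponent the
  -- form in which the formula has it.
  count-fixed-row : count (fixed? true false) ≡ k ^ (n * ⌈ m /2⌉)
  count-fixed-row = count-enumeration (fixed? true false)
    (enumerate-fixed true false retract section
      (λ y → let j , i = remQuot {n} ⌈ m /2⌉ y in
        trans (cong (combine j) (fold-unfold {m} i)) (Fin.combine-remQuot {n} ⌈ m /2⌉ y))
      (λ { (i , j) → cong (combine j) (fold-flip true i) })
      section-retract)
    where
    retract : Vertex m n → Fin (n * ⌈ m /2⌉)
    retract (i , j) = combine j (fold i)
    section : Fin (n * ⌈ m /2⌉) → Vertex m n
    section y = let j , i = remQuot {n} ⌈ m /2⌉ y in unfold i , j
    section-combine : ∀ j y → section (combine j y) ≡ (unfold y , j)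
    section-combine j y = cong (λ (j , i) → unfold i , j) (Fin.remQuot-combine {n} j y)
    section-retract : ∀ v → section (retract v) ≡ v ⊎ section (retract v) ≡ reflect true false v
    section-retract (i , j) with unfold-fold i
    ... | false , eq = inj₁ (trans (section-combine j (fold i)) (cong (_, j) eq))
    ... | true  , eq = inj₂ (trans (section-combine j (fold i)) (cong (_, j) eq))

  count-fixed-column : count (fixed? false true) ≡ k ^ (m * ⌈ n /2⌉)
  count-fixed-column = count-enumeration (fixed? false true)
    (enumerate-fixed false true retract section
      (λ y → let i , j = remQuot {m} ⌈ n /2⌉ y in
        trans (cong (combine i) (fold-unfold {n} j)) (Fin.combine-remQuot {m} ⌈ n /2⌉ y))
      (λ { (i , j) → cong (combine i) (fold-flip true j) })
      section-retract)
    where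
    retract : Vertex m n → Fin (m * ⌈ n /2⌉)
    retract (i , j) = combine i (fold j)
    section : Fin (m * ⌈ n /2⌉) → Vertex m n
    section y = map₂ unfold (remQuot {m} ⌈ n /2⌉ y)
    section-combine : ∀ i y → section (combine i y) ≡ (i , unfold y)
    section-combine i y = cong (map₂ unfold) (Fin.remQuot-combine {m} i y)
    section-retract : ∀ v → section (retract v) ≡ v ⊎ section (retract v) ≡ reflect false true v
    section-retract (i , j) with unfold-fold j
    ... | false , eq = inj₁ (trans (section-combine i (fold j)) (cong (i ,_) eq))
    ... | true  , eq = inj₂ (trans (section-combine i (fold j)) (cong (i ,_) eq))

  -- Numbering the vertices row by row turns the rotation into the reversal of a
  -- path on m n vertices.
  count-fixed-rotation : count (fixed? true true) ≡ k ^ ⌈ m * n /2⌉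
  count-fixed-rotation = count-enumeration (fixed? true true)
    (enumerate-fixed true true retract section
      (λ y → trans (cong fold (Fin.combine-remQuot {m} n (unfold y))) (fold-unfold y))
      (λ { (i , j) → trans (cong fold (sym (opposite-combine i j))) (fold-flip true (combine i j)) })
      section-retract)
    where
    retract : Vertex m n → Fin ⌈ m * n /2⌉
    retract (i , j) = fold (combine i j)
    section : Fin ⌈ m * n /2⌉ → Vertex m n
    section y = remQuot {m} n (unfold y)
    section-retract : ∀ v → section (retract v) ≡ v ⊎ section (retract v) ≡ reflect true true v
    section-retract (i , j) with unfold-fold (combine i j)
    ... | false , eq = inj₁ (trans (cong (remQuot {m} n) eq) (Fin.remQuot-combine i j))
    ... | true  , eq = inj₂ (trans (cong (remQuot {m} n) (trans eq (opposite-combine i j)))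
                                   (Fin.remQuot-combine (opposite i) (opposite j)))

  count-fixedByAll : count fixedByAll? ≡ k ^ (⌈ m /2⌉ * ⌈ n /2⌉)
  count-fixedByAll = count-enumeration fixedByAll?
    (enumerate-invariant retract section
      (λ y → let i , j = remQuot {⌈ m /2⌉} ⌈ n /2⌉ y in
        trans (cong₂ combine (fold-unfold {m} i) (fold-unfold {n} j)) (Fin.combine-remQuot {⌈ m /2⌉} ⌈ n /2⌉ y))
      (λ c → invariant⇒fixed true false (c ∘ retract)
               (λ { (i , j) → cong (λ y → c (combine y (fold j))) (fold-flip true i) })
           , invariant⇒fixed false true (c ∘ retract)
               (λ { (i , j) → cong (λ y → c (combine (fold i) y)) (fold-flip true j) }))
      invariant)
    where
    retract : Vertex m n → Fin (⌈ m /2⌉ * ⌈ n /2⌉)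
    retract (i , j) = combine (fold i) (fold j)
    section : Fin (⌈ m /2⌉ * ⌈ n /2⌉) → Vertex m n
    section y = map unfold unfold (remQuot {⌈ m /2⌉} ⌈ n /2⌉ y)
    section-combine : ∀ y z → section (combine y z) ≡ (unfold y , unfold z)
    section-combine y z = cong (map unfold unfold) (Fin.remQuot-combine {⌈ m /2⌉} y z)
    -- The two coordinates fold independently, so any of the four reflections may separate a vertex
    -- from its representative.
    reflect-invariant : ∀ s t {x} → FixedByAll x → ∀ v → decode x (reflect s t v) ≡ decode x v
    reflect-invariant false false _       v = refl
    reflect-invariant true  false (a , _) v = fixed⇒invariant true false a v
    reflect-invariant false true  (_ , b) v = fixed⇒invariant false true b v
    reflect-invariant true  true  (a , b) v =
      trans (fixed⇒invariant true false a (reflect false true v)) (fixed⇒invariant false true b v)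
    invariant : ∀ {x} → FixedByAll x → ∀ v → decode x (section (retract v)) ≡ decode x v
    invariant {x} fix (i , j)
      with s , eqᵢ ← unfold-fold i | t , eqⱼ ← unfold-fold j =
      trans (cong (decode x) (trans (section-combine (fold i) (fold j)) (cong₂ _,_ eqᵢ eqⱼ)))
             (reflect-invariant s t fix (i , j))

  count-canonical :
    4 * count canonical? + (k ^ (n * ⌈ m /2⌉) + k ^ (m * ⌈ n /2⌉) + k ^ ⌈ m * n /2⌉)
    ≡ k ^ (m * n) + (k ^ (⌈ m /2⌉ * ⌈ n /2⌉) + k ^ (⌈ m /2⌉ * ⌈ n /2⌉))
  count-canonical = begin
    4 * count canonical? + (k ^ (n * ⌈ m /2⌉) + k ^ (m * ⌈ n /2⌉) + k ^ ⌈ m * n /2⌉)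
      ≡⟨ cong (_+_ (4 * count canonical?))
           (cong₂ _+_ (cong₂ _+_ count-fixed-row count-fixed-column) count-fixed-rotation) ⟨
    4 * count canonical? + (count (fixed? true false) + count (fixed? false true) + count (fixed? true true))
      ≡⟨ count-inclusion-exclusion ⟩
    k ^ (m * n) + (count fixedByAll? + count fixedByAll?)
      ≡⟨ cong (λ d → k ^ (m * n) + (d + d)) count-fixedByAll ⟩
    k ^ (m * n) + (k ^ (⌈ m /2⌉ * ⌈ n /2⌉) + k ^ (⌈ m /2⌉ * ⌈ n /2⌉)) ∎
    where open ≡-Reasoning

  -- Equivalence classes of distinguishing colorings as free orbits

  module _
    (classify : ∀ (α : Automorphism (P m □ P n)) → ∃₂ λ s t → ∀ v → to α v ≡ reflect s t v)
    (faithful : ∀ s t → (∀ (v : Vertex m n) → reflect s t v ≡ v) → s ≡ false × t ≡ false)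
    where

    private
      G : Graph
      G = P m □ P n

    -- A reflection fixing a distinguishing coloring acts as the identity on vertices, hence is the
    -- trivial one by `faithful`.
    distinguishing⇒free : ∀ c → Distinguishing G c → Free (encode c)
    distinguishing⇒free c dist =
      (λ fix → not-fixed true  false (λ ()) fix) ,
      (λ fix → not-fixed false true  (λ ()) fix) ,
      (λ fix → not-fixed true  true  (λ ()) fix)
      where
      not-fixed : ∀ s t → ¬ (s ≡ false × t ≡ false) → ¬ Fixed s t (encode c)
      not-fixed s t nontrivial fix = nontrivial (faithful s t (dist (reflectᴬ s t) λ v →
        trans (sym (decode-encode c (reflect s t v)))
              (trans (fixed⇒invariant s t fix v) (decode-encode c v))))

    free⇒distinguishing : ∀ x → Free x → Distinguishing G (decode x)
    free⇒distinguishing x free α inv v with s , t , α≗ ← classify α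
      -- The reflection `α` fixes `x`, so freeness makes both flags `false`, and `α≗ v` then says
      -- that `v` is fixed.
      with refl , refl ← free-fixed s t free (trans
             (encode-cong λ v → trans (cong (decode x) (sym (α≗ v))) (inv v)) (encode-decode x)) = α≗ v

    equivalent⇒orbit : ∀ c d → Equivalent G c d → ∃₂ λ s t → encode c ≡ act s t (encode d)
    equivalent⇒orbit c d (α , eq) = let s , t , α≗ = classify α in
      s , t , encode-cong λ v → trans (eq v) (trans (cong d (α≗ v)) (sym (decode-encode d (reflect s t v))))

    -- Since all automorphisms are reflections, equivalence classes are orbits; a class is indexed
    -- by the rank of its canonical point.
    Φ-count-canonical : Φ k [ G ]≔ count canonical?
    Φ-count-canonical = record
      { to        = class
      ; from      = coloring
      ; to-cong   = λ {x} {y} → class-cong x y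
      ; from-cong = λ { refl → idᴬ , λ _ → refl }
      ; inverse   = (λ {y} {x} x≈ → trans (class-cong x (coloring y) x≈) (class-coloring y))
                  , (λ { {x} refl → coloring-class x })
      }
      where
      open Enumeration (enumerate canonical?)
      open Setoid (DistinguishingColorings k G) using (Carrier; _≈_)

      canonical-form : ∀ ((c , dist) : Carrier) → Canonical (representative (encode c))
      canonical-form (c , dist) = canonical-representative (distinguishing⇒free c dist)

      class : Carrier → Fin (count canonical?)
      class x = rank (canonical-form x)

      coloring : Fin (count canonical?) → Carrier
      coloring y = decode (index y) , free⇒distinguishing (index y) (proj₁ (index-satisfies y))

      class-cong : ∀ x y → x ≈ y → class x ≡ class y
      class-cong x@(c , _) y@(d , _) x≈y = let s , t , eq = equivalent⇒orbit c d x≈y in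
        rank-cong (canonical-form x) (canonical-form y)
          (trans (cong representative eq) (representative-act s t (encode d)))

      class-coloring : ∀ y → class (coloring y) ≡ y
      class-coloring y = trans
        (rank-cong (canonical-form (coloring y)) (index-satisfies y)
          (trans (cong representative (encode-decode (index y))) (proj₂ (index-satisfies y))))
        (rank-index (index-satisfies y))

      coloring-class : ∀ x → coloring (class x) ≈ x
      coloring-class x@(c , _) = let s , t , eq = representative-orbit (encode c) in
        -- The equivalence is the reflection at which the orbit minimum is attained.
        reflectᴬ s t , λ v → begin
          decode (index (class x)) v            ≡⟨ cong (λ y → decode y v) (trans (index-rank (canonical-form x)) eq) ⟩
          decode (act s t (encode c)) v         ≡⟨ decode-encode _ v ⟩
          decode (encode c) (reflect s t v)     ≡⟨ decode-encode c (reflect s t v) ⟩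
          c (reflect s t v)                     ∎
        where open ≡-Reasoning

-- From the subtraction-free count to the rational formula

N/1≡z/4 : ∀ N z → + (4 * N) ≡ z → + N / 1 ≡ z / 4
-- `mkℚᵘ` stores the denominator minus one, so 0 and 3 encode 1 and 4; the equality is then checked
-- by cross-multiplication.
N/1≡z/4 N z eq = ℚ.fromℚᵘ-cong {mkℚᵘ (+ N) 0} {mkℚᵘ z 3} (*≡* (begin
  + N ℤ.* + 4   ≡⟨ ℤ.*-comm (+ N) (+ 4) ⟩
  + 4 ℤ.* + N   ≡⟨ ℤ.pos-* 4 N ⟨
  + (4 * N)     ≡⟨ eq ⟩
  z             ≡⟨ ℤ.*-identityʳ z ⟨
  z ℤ.* + 1     ∎))
  where open ≡-Reasoning

solve-for-4N : ∀ N a b c d K → 4 * N + (a + b + c) ≡ K + (d + d) →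
               + (4 * N) ≡ + K - + b - + a - + c ℤ.+ + (2 * d)
solve-for-4N N a b c d K eq = begin
  + (4 * N)
    ≡⟨ isolate (+ (4 * N)) (+ a) (+ b) (+ c) ⟩
  (+ (4 * N) ℤ.+ (+ a ℤ.+ + b ℤ.+ + c)) - + a - + b - + c
    ≡⟨ cong (λ z → z - + a - + b - + c) (cong +_ eq) ⟩
  (+ K ℤ.+ (+ d ℤ.+ + d)) - + a - + b - + c
    ≡⟨ reorder (+ K) (+ a) (+ b) (+ c) (+ d) ⟩
  + K - + b - + a - + c ℤ.+ + 2 ℤ.* + d
    ≡⟨ cong (λ z → + K - + b - + a - + c ℤ.+ z) (sym (ℤ.pos-* 2 d)) ⟩
  + K - + b - + a - + c ℤ.+ + (2 * d) ∎
  where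
  open ≡-Reasoning
  isolate : ∀ x a b c → x ≡ (x ℤ.+ (a ℤ.+ b ℤ.+ c)) - a - b - c
  isolate = ℤ-Solver.solve-∀
  reorder : ∀ K a b c d → (K ℤ.+ (d ℤ.+ d)) - a - b - c ≡ K - b - a - c ℤ.+ + 2 ℤ.* d
  reorder = ℤ-Solver.solve-∀

theorem5p1 : ∀ (m n k : ℕ) → 2 ≤ m → 2 ≤ n → m ≢ n → 2 ≤ k →
    ∃[ N ] (Φ k [ P m □ P n ]≔ N) ×
    (+ N / 1 ≡
    (+ (k ^ (m * n)) - + (k ^ (m * ⌈ n /2⌉)) - + (k ^ (n * ⌈ m /2⌉))
    - + (k ^ ⌈ m * n /2⌉) ℤ.+ + (2 * k ^ (⌈ m /2⌉ * ⌈ n /2⌉))) / 4)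
theorem5p1 m@(suc (suc _)) n@(suc (suc _)) k (s≤s (s≤s _)) (s≤s (s≤s _)) m≢n _ =
  count canonical? ,
  -- The classification is phrased in the largest indices m - 1 and n - 1, which are nonzero because
  -- m and n are at least 2, and distinct because m and n are.
  Φ-count-canonical (automorphism⇒reflect (λ ()) (λ ()) (m≢n ∘ cong suc))
                    (reflect-faithful (λ ()) (λ ()) (m≢n ∘ cong suc)) ,
  N/1≡z/4 (count canonical?) _ (solve-for-4N (count canonical?)
    (k ^ (n * ⌈ m /2⌉)) (k ^ (m * ⌈ n /2⌉)) (k ^ ⌈ m * n /2⌉)
    (k ^ (⌈ m /2⌉ * ⌈ n /2⌉)) (k ^ (m * n)) count-canonical)
  where open Colorings m n k
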